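{- Let $\ell\geq 3$ and $k\geq \ell-2$ be integers. There is $n_0=n_0(k,\ell)$ such that for every $n\geq n_0$ the following holds. If $\mathcal{F}\subset\binom{[n]}{k}$ is a family such that $$\binom{\ell-1}{2}\leq \sum_{1\leq i<j\leq \ell}|F_i\cap F_j|$$ holds for every choice of $\ell$ distinct members $F_1,\dots,F_\ell$ of $\mathcal{F}$, then $$|\mathcal{F}|\leq \binom{n-1}{k-1}+\binom{n-\ell+1}{k-\ell+2}.$$
   Context: $[n]=\{1,\dots,n\}$ and $\binom{[n]}{k}$ denotes the family of all $k$-element subsets of $[n]$. -}

module Defs where

open import Data.Nat using (ℕ; zero; suc; _+_; _<ᵇ_)
open import Data.Fin using (Fin; toℕ)
open import Data.Fin.Subset using (Subset; _∩_; ∣_∣)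
open import Data.Bool using (if_then_else_)

sumFin : ∀ {m} → (Fin m → ℕ) → ℕ
sumFin {zero}  f = 0
sumFin {suc m} f = f Fin.zero + sumFin (λ i → f (Fin.suc i))

pairSum : ∀ {ℓ n} → (Fin ℓ → Subset n) → ℕ
pairSum F = sumFin λ i → sumFin λ j →
  if toℕ i <ᵇ toℕ j then ∣ F i ∩ F j ∣ else 0

module Submission where

-- A maximal family of pairwise disjoint members of 𝓕 has fewer than ℓ of them, so some set of
-- at most kℓ points meets every member; unless 𝓕 is small, one of these points, x, has degree
-- of order n^(k−1). Given A and B in 𝓕 avoiding x, the degree is large enough to choose greedily
-- ℓ − 2 members through x that are disjoint from A ∪ B and meet each other only in x. Their pair
-- sum is C(ℓ−2, 2), so the hypothesis forces ∣A ∩ B∣ ≥ C(ℓ−1, 2) − C(ℓ−2, 2) = ℓ − 2. The members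
-- avoiding x thus form an (ℓ−2)-intersecting family on n − 1 points, and Erdős–Ko–Rado bounds it
-- by C(n−ℓ+1, k−ℓ+2), while at most C(n−1, k−1) members contain x.

open import Defs
import Data.Bool as Bool
open import Data.Fin using (Fin; zero; suc)
open import Data.Fin.Subset using (Subset; ∣_∣; ⁅_⁆; _∩_; _∪_; ∁; inside; outside; _⊆_; _∉_) renaming (_∈_ to _∈ˢ_; ⊥ to ∅)
open import Data.Fin.Subset.Properties
open import Data.List using (List; []; _∷_; _++_; length; map; filter; lookup)
open import Data.List.Membership.Propositional using (_∈_; find; lose)
open import Data.List.Membership.Propositional.Properties using (∈-filter⁻; ∈-lookup; ∈-map⁺)
open import Data.List.Properties using (length-map; length-++)
import Data.List.Relation.Binary.Sublist.Propositional.Properties as Sublist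
open import Data.List.Relation.Unary.All as All using (All; []; _∷_)
import Data.List.Relation.Unary.All.Properties as All
open import Data.List.Relation.Unary.AllPairs using (AllPairs; []; _∷_)
open import Data.List.Relation.Unary.Any as Any using (Any; here; there; any?)
import Data.List.Relation.Unary.Any.Properties as Any
open import Data.List.Relation.Unary.Unique.Propositional using (Unique)
import Data.List.Relation.Unary.Unique.Propositional.Properties as Unique
open import Data.Nat
open import Data.Nat.Combinatorics using (_C_; nC1≡n; nCk+nC[k+1]≡[n+1]C[k+1])
open import Data.Nat.Properties
open import Data.Product using (_×_; _,_; proj₁; proj₂; ∃-syntax)
open import Data.Sum using (_⊎_; inj₁; inj₂)
open import Data.Vec using (_∷_; []; here; there)
open import Data.Vec.Properties using (≡-dec)
open import Function using (_∘_)
open import Function.Definitions using (Injective)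
open import Relation.Binary.PropositionalEquality
open import Relation.Nullary using (¬_; yes; no; ¬?; contradiction; decidable-stable; _×-dec_)
open import Relation.Unary using (Decidable)

private
  variable
    n : ℕ
    X : Set

-- Binomial coefficients

absorption : ∀ N r → suc r * (suc N C suc r) ≡ suc N * (N C r)
absorption zero zero = refl
absorption zero (suc r) = *-zeroʳ r
absorption (suc N) zero = trans (*-identityˡ _) (trans (nC1≡n (suc (suc N))) (sym (*-identityʳ _)))
absorption (suc N) (suc r) = begin
  suc (suc r) * (suc (suc N) C suc (suc r))
    ≡⟨ cong (suc (suc r) *_) (sym (nCk+nC[k+1]≡[n+1]C[k+1] (suc N) (suc r))) ⟩
  suc (suc r) * (suc N C suc r + suc N C suc (suc r))
    ≡⟨ *-distribˡ-+ (suc (suc r)) (suc N C suc r) _ ⟩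
  (suc N C suc r + suc r * (suc N C suc r)) + suc (suc r) * (suc N C suc (suc r))
    ≡⟨ cong₂ (λ a b → (suc N C suc r + a) + b) (absorption N r) (absorption N (suc r)) ⟩
  (suc N C suc r + suc N * (N C r)) + suc N * (N C suc r)
    ≡⟨ +-assoc (suc N C suc r) _ _ ⟩
  suc N C suc r + (suc N * (N C r) + suc N * (N C suc r))
    ≡⟨ cong (suc N C suc r +_) (sym (*-distribˡ-+ (suc N) (N C r) _)) ⟩
  suc N C suc r + suc N * (N C r + N C suc r)
    ≡⟨ cong (λ a → suc N C suc r + suc N * a) (nCk+nC[k+1]≡[n+1]C[k+1] N r) ⟩
  suc (suc N) * (suc N C suc r) ∎
  where open ≡-Reasoning

-- The value 0 at r = 0 reflects that a (j + r)-set cannot contain j + 1 points when r = 0; see between-count⁻.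
_C⁻_ : ℕ → ℕ → ℕ
N C⁻ zero  = 0
N C⁻ suc r = pred N C r

-- By `absorption`, C(N, r) is N/r times C(N - 1, r - 1), so a lower bound on N linear in K absorbs
-- the constant factor K. Every condition that n be large enters through this estimate.
C⁻-small : ∀ K N r → K * r ≤ N → K * (N C⁻ r) ≤ N C r
C⁻-small K N zero _ = ≤-trans (≤-reflexive (*-zeroʳ K)) z≤n
C⁻-small zero N (suc r) _ = z≤n
C⁻-small (suc K) (suc N) (suc r) Kr≤N = *-cancelˡ-≤ (suc r) (begin
  suc r * (suc K * (N C r)) ≡⟨ sym (*-assoc (suc r) (suc K) _) ⟩
  suc r * suc K * (N C r)   ≡⟨ cong (_* (N C r)) (*-comm (suc r) (suc K)) ⟩
  suc K * suc r * (N C r)   ≤⟨ *-monoˡ-≤ (N C r) Kr≤N ⟩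
  suc N * (N C r)           ≡⟨ sym (absorption N r) ⟩
  suc r * (suc N C suc r)   ∎)
  where open ≤-Reasoning

[1+m]C2≡m+mC2 : ∀ m → suc m C 2 ≡ m + m C 2
[1+m]C2≡m+mC2 m = trans (sym (nCk+nC[k+1]≡[n+1]C[k+1] m 1)) (cong (_+ m C 2) (nC1≡n m))

-- Counting in lists without repetition

length-filter-∁ : {P : X → Set} (P? : Decidable P) (xs : List X) →
  length xs ≡ length (filter P? xs) + length (filter (¬? ∘ P?) xs)
length-filter-∁ P? [] = refl
length-filter-∁ P? (x ∷ xs) with P? x
... | yes _ = cong suc (length-filter-∁ P? xs)
... | no  _ = trans (cong suc (length-filter-∁ P? xs)) (sym (+-suc _ _))

length-filter-filter : {P Q : X → Set} (P? : Decidable P) (Q? : Decidable Q) (xs : List X) →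
  length (filter P? (filter Q? xs)) ≤ length (filter P? xs)
length-filter-filter P? Q? xs =
  Sublist.length-mono-≤ (Sublist.filter⁺ P? P? (λ { refl p → p }) (Sublist.filter-⊆ Q? xs))

-- Quantifying over duplicate-free lists bounds the size of an arbitrary predicate without deciding
-- or enumerating it.
AtMost : ℕ → (X → Set) → Set
AtMost c P = ∀ xs → Unique xs → All P xs → length xs ≤ c

AtMost-≤ : ∀ {c d} {P : X → Set} → c ≤ d → AtMost c P → AtMost d P
AtMost-≤ c≤d P≤ xs u ps = ≤-trans (P≤ xs u ps) c≤d

AtMost-⊆ : ∀ {c} {P Q : X → Set} → (∀ {x} → P x → Q x) → AtMost c Q → AtMost c P
AtMost-⊆ P⊆Q Q≤ xs u ps = Q≤ xs u (All.map P⊆Q ps)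

AtMost-none : ∀ {c} {P : X → Set} → (∀ {x} → ¬ P x) → AtMost c P
AtMost-none ¬P [] _ _ = z≤n
AtMost-none ¬P (x ∷ xs) _ (p ∷ _) = contradiction p ¬P

tails : ∀ b {P : Subset (suc n) → Set} {xs} → Unique xs → All P xs → All (λ A → ∃[ B ] A ≡ b ∷ B) xs →
  ∃[ ys ] xs ≡ map (b ∷_) ys × Unique ys × All (P ∘ (b ∷_)) ys
tails b [] [] [] = [] , refl , [] , []
tails b u@(_ ∷ u′) (p ∷ ps) ((B , refl) ∷ qs) with tails b u′ ps qs
... | ys , refl , _ , ps′ = B ∷ ys , refl , Unique.map⁻ u , p ∷ ps′

AtMost-∷ : ∀ b {a} {P : Subset (suc n) → Set} → AtMost a (P ∘ (b ∷_)) →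
  AtMost a (λ A → P A × ∃[ B ] A ≡ b ∷ B)
AtMost-∷ b P≤ xs u pqs with tails b u (All.map proj₁ pqs) (All.map proj₂ pqs)
... | ys , refl , u′ , ps = ≤-trans (≤-reflexive (length-map _ ys)) (P≤ ys u′ ps)

AtMost-split : ∀ {a b} {P : Subset (suc n) → Set} →
  AtMost a (P ∘ (inside ∷_)) → AtMost b (P ∘ (outside ∷_)) → AtMost (a + b) P
AtMost-split {a = a} {b} {P} P≤a P≤b xs u ps = begin
  length xs ≡⟨ length-filter-∁ (zero ∈?_) xs ⟩
  length (filter (zero ∈?_) xs) + length (filter (¬? ∘ (zero ∈?_)) xs)
    ≤⟨ +-mono-≤
         (AtMost-∷ inside P≤a _ (Unique.filter⁺ _ u)
           (All.map head-in (All.zip (All.filter⁺ (zero ∈?_) ps , All.all-filter (zero ∈?_) xs))))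
         (AtMost-∷ outside P≤b _ (Unique.filter⁺ _ u)
           (All.map head-out (All.zip (All.filter⁺ (¬? ∘ (zero ∈?_)) ps , All.all-filter (¬? ∘ (zero ∈?_)) xs)))) ⟩
  a + b ∎
  where
  open ≤-Reasoning
  head-in : ∀ {A} → P A × zero ∈ˢ A → P A × ∃[ B ] A ≡ inside ∷ B
  head-in (p , here) = p , _ , refl
  head-out : ∀ {A} → P A × zero ∉ A → P A × ∃[ B ] A ≡ outside ∷ B
  head-out {inside ∷ A} (p , 0∉A) = contradiction here 0∉A
  head-out {outside ∷ A} (p , _) = p , A , refl

-- Sets with prescribed and forbidden points

Avoids : Subset n → Subset n → Set
Avoids Y A = ∀ {y} → y ∈ˢ Y → y ∉ A

avoids-size : (Y A : Subset n) → Avoids Y A → ∣ A ∣ + ∣ Y ∣ ≤ n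
avoids-size [] [] _ = z≤n
avoids-size (inside ∷ Y) (inside ∷ A) av = contradiction here (av here)
avoids-size (inside ∷ Y) (outside ∷ A) av =
  ≤-trans (≤-reflexive (+-suc _ _)) (s≤s (avoids-size Y A (λ y∈Y y∈A → av (there y∈Y) (there y∈A))))
avoids-size (outside ∷ Y) (inside ∷ A) av = s≤s (avoids-size Y A (λ y∈Y y∈A → av (there y∈Y) (there y∈A)))
avoids-size (outside ∷ Y) (outside ∷ A) av = m≤n⇒m≤1+n (avoids-size Y A (λ y∈Y y∈A → av (there y∈Y) (there y∈A)))

avoids-∅ : (A : Subset n) → Avoids ∅ A
avoids-∅ A y∈∅ = contradiction y∈∅ ∉⊥

Between : (k : ℕ) (T Y : Subset n) → Subset n → Set
Between k T Y A = ∣ A ∣ ≡ k × T ⊆ A × Avoids Y A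

between-∷ : ∀ {k s t b} {T Y A : Subset n} → Between k (s ∷ T) (t ∷ Y) (b ∷ A) → T ⊆ A × Avoids Y A
between-∷ (_ , T⊆A , av) = drop-∷-⊆ T⊆A , λ y∈Y y∈A → av (there y∈Y) (there y∈A)

-- Induction on the ground set: a first point in T or Y leaves at most one choice, and a free one
-- gives Pascal's rule through `AtMost-split`. Writing the size as `∣ T ∣ + r` keeps subtraction out
-- of the lower index.
between-count : ∀ r (T Y : Subset n) → AtMost ((n ∸ (∣ T ∣ + ∣ Y ∣)) C r) (Between (∣ T ∣ + r) T Y)
between-count zero [] [] [] _ _ = z≤n
between-count zero [] [] ([] ∷ []) _ _ = s≤s z≤n
between-count zero [] [] ([] ∷ [] ∷ _) ((≢ ∷ _) ∷ _) _ = contradiction refl ≢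
between-count (suc r) [] [] = AtMost-none λ { {[]} (() , _) }
between-count r (inside ∷ T) (inside ∷ Y) = AtMost-none λ (_ , T⊆A , av) → av here (T⊆A here)
between-count r (inside ∷ T) (outside ∷ Y) =
  subst (λ c → AtMost c (Between (suc (∣ T ∣ + r)) (inside ∷ T) (outside ∷ Y))) (+-identityʳ _)
  (AtMost-split
    (AtMost-⊆ (λ B → suc-injective (proj₁ B) , between-∷ B) (between-count r T Y))
    (AtMost-none {c = 0} λ (_ , T⊆A , _) → contradiction (T⊆A here) λ ()))
between-count {suc n} r (outside ∷ T) (inside ∷ Y) =
  subst (λ c → AtMost ((suc n ∸ c) C r) (Between (∣ T ∣ + r) (outside ∷ T) (inside ∷ Y))) (sym (+-suc ∣ T ∣ ∣ Y ∣))
  (AtMost-split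
    (AtMost-none {c = 0} λ (_ , _ , av) → av here here)
    (AtMost-⊆ (λ B → proj₁ B , between-∷ B) (between-count r T Y)))
between-count {suc n} r (outside ∷ T) (outside ∷ Y) with ∣ T ∣ + ∣ Y ∣ ≤? n
-- Here T and Y overlap, so nothing lies between. In the other case `suc n ∸ s` is 1 + (n ∸ s) for s
-- = ∣ T ∣ + ∣ Y ∣, as Pascal's rule requires.
... | no s≰n = AtMost-none λ
  { {_ ∷ A} B@(_ , _) → let T⊆A , av = between-∷ B in
      s≰n (≤-trans (+-monoˡ-≤ ∣ Y ∣ (p⊆q⇒∣p∣≤∣q∣ T⊆A)) (avoids-size Y A av)) }
between-count {suc n} zero (outside ∷ T) (outside ∷ Y) | yes _ =
  AtMost-split
    -- A set of size ∣ T ∣ that contains T has no room for the free first point.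
    (AtMost-none {c = 0} λ {A} B → <-irrefl refl (begin-strict
      ∣ A ∣ <⟨ ≤-reflexive (proj₁ B) ⟩
      ∣ T ∣ + 0 ≡⟨ +-identityʳ _ ⟩
      ∣ T ∣ ≤⟨ p⊆q⇒∣p∣≤∣q∣ (proj₁ (between-∷ B)) ⟩
      ∣ A ∣ ∎))
    (AtMost-⊆ (λ B → proj₁ B , between-∷ B) (between-count zero T Y))
  where open ≤-Reasoning
between-count {suc n} (suc r) (outside ∷ T) (outside ∷ Y) | yes s≤n =
  subst (λ c → AtMost c (Between (∣ T ∣ + suc r) (outside ∷ T) (outside ∷ Y)))
    (trans (nCk+nC[k+1]≡[n+1]C[k+1] (n ∸ (∣ T ∣ + ∣ Y ∣)) r) (cong (_C suc r) (sym (+-∸-assoc 1 s≤n))))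
  (AtMost-split
    (AtMost-⊆ (λ B → suc-injective (trans (proj₁ B) (+-suc _ _)) , between-∷ B) (between-count r T Y))
    (AtMost-⊆ (λ B → proj₁ B , between-∷ B) (between-count (suc r) T Y)))

-- The shape that `C⁻-small` accepts: prescribing one point beyond j lowers both indices by one, and
-- at r = 0 no set qualifies.
between-count⁻ : ∀ j r (T Y : Subset n) → ∣ T ∣ ≡ suc j →
  AtMost ((n ∸ (j + ∣ Y ∣)) C⁻ r) (Between (j + r) T Y)
between-count⁻ j zero T Y ∣T∣ = AtMost-none λ {A} (∣A∣ , T⊆A , _) → <-irrefl refl (begin-strict
  j     <⟨ ≤-reflexive (sym ∣T∣) ⟩
  ∣ T ∣ ≤⟨ p⊆q⇒∣p∣≤∣q∣ T⊆A ⟩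
  ∣ A ∣ ≡⟨ ∣A∣ ⟩
  j + 0 ≡⟨ +-identityʳ j ⟩
  j     ∎)
  where open ≤-Reasoning
between-count⁻ {n} j (suc r) T Y ∣T∣ =
  subst₂ (λ N k → AtMost (N C r) (Between k T Y))
    (trans (cong (λ s → n ∸ (s + ∣ Y ∣)) ∣T∣) (sym (pred[m∸n]≡m∸[1+n] n (j + ∣ Y ∣))))
    (trans (cong (_+ r) ∣T∣) (sym (+-suc j r)))
    (between-count r T Y)

-- Covers

Hits : List (Fin n) → Subset n → Set
Hits S A = Any (_∈ˢ A) S

hits? : (S : List (Fin n)) → Decidable (Hits S)
hits? S A = any? (_∈? A) S

-- Union bound over S: members through the first point number at most c, and those missing it are
-- still hit by the remaining points.
length-cover : ∀ (S : List (Fin n)) c xs → All (Hits S) xs →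
  All (λ y → length (filter (y ∈?_) xs) ≤ c) S → length xs ≤ length S * c
length-cover [] c [] _ _ = z≤n
length-cover [] c (x ∷ xs) (() ∷ _) _
length-cover (y ∷ S) c xs hs (d ∷ ds) = begin
  length xs ≡⟨ length-filter-∁ (y ∈?_) xs ⟩
  length (filter (y ∈?_) xs) + length rest ≤⟨ +-mono-≤ d (length-cover S c rest rest-hit
     (All.map (≤-trans (length-filter-filter _ (¬? ∘ (y ∈?_)) xs)) ds)) ⟩
  c + length S * c ∎
  where
  open ≤-Reasoning
  rest = filter (¬? ∘ (y ∈?_)) xs
  rest-hit : All (Hits S) rest
  rest-hit = All.map (λ (h , y∉A) → Any.tail y∉A h)
    (All.zip (All.filter⁺ (¬? ∘ (y ∈?_)) hs , All.all-filter (¬? ∘ (y ∈?_)) xs))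

AtMost-cover : ∀ (S : List (Fin n)) {c} {P : Subset n → Set} → (∀ {A} → P A → Hits S A) →
  All (λ y → AtMost c (λ A → P A × y ∈ˢ A)) S → AtMost (length S * c) P
AtMost-cover S {c} hit ds xs u ps = length-cover S c xs (All.map hit ps)
  (All.map (λ {y} d → d _ (Unique.filter⁺ (y ∈?_) u)
    (All.zip (All.filter⁺ (y ∈?_) ps , All.all-filter (y ∈?_) xs))) ds)

elements : Subset n → List (Fin n)
elements [] = []
elements (inside ∷ A) = zero ∷ map suc (elements A)
elements (outside ∷ A) = map suc (elements A)

length-elements : (A : Subset n) → length (elements A) ≡ ∣ A ∣
length-elements [] = refl
length-elements (inside ∷ A) = cong suc (trans (length-map suc (elements A)) (length-elements A))
length-elements (outside ∷ A) = trans (length-map suc (elements A)) (length-elements A)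

∈-elements⁺ : ∀ {y} {A : Subset n} → y ∈ˢ A → y ∈ elements A
∈-elements⁺ here = here refl
∈-elements⁺ {A = inside ∷ A} (there y∈A) = there (∈-map⁺ suc (∈-elements⁺ y∈A))
∈-elements⁺ {A = outside ∷ A} (there y∈A) = ∈-map⁺ suc (∈-elements⁺ y∈A)

all-elements : (A : Subset n) → All (_∈ˢ A) (elements A)
all-elements [] = []
all-elements (inside ∷ A) = here ∷ All.map⁺ (All.map there (all-elements A))
all-elements (outside ∷ A) = All.map⁺ (All.map there (all-elements A))

hits-elements : ∀ {y} {A B : Subset n} → y ∈ˢ A → y ∈ˢ B → Hits (elements A) B
hits-elements y∈A y∈B = lose (∈-elements⁺ y∈A) y∈B

∣T∪⁅y⁆∣ : ∀ {y} (T : Subset n) → y ∉ T → ∣ T ∪ ⁅ y ⁆ ∣ ≡ suc ∣ T ∣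
∣T∪⁅y⁆∣ {y = zero} (inside ∷ T) y∉T = contradiction here y∉T
∣T∪⁅y⁆∣ {y = zero} (outside ∷ T) y∉T = cong (suc ∘ ∣_∣) (∪-identityʳ T)
∣T∪⁅y⁆∣ {y = suc y} (inside ∷ T) y∉T = cong suc (∣T∪⁅y⁆∣ T (y∉T ∘ there))
∣T∪⁅y⁆∣ {y = suc y} (outside ∷ T) y∉T = ∣T∪⁅y⁆∣ T (y∉T ∘ there)

⁅⁆-⊆ : ∀ {x} {A : Subset n} → x ∈ˢ A → ⁅ x ⁆ ⊆ A
⁅⁆-⊆ {x = x} {A} x∈A z∈ = subst (_∈ˢ A) (sym (x∈⁅y⁆⇒x≡y x z∈)) x∈A

∪⁅⁆-⊆ : ∀ {y} {T A : Subset n} → T ⊆ A → y ∈ˢ A → T ∪ ⁅ y ⁆ ⊆ A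
∪⁅⁆-⊆ {y = y} {T} T⊆A y∈A z∈ with x∈p∪q⁻ T ⁅ y ⁆ z∈
... | inj₁ z∈T = T⊆A z∈T
... | inj₂ z∈y rewrite x∈⁅y⁆⇒x≡y y z∈y = y∈A

lookup-injective : {xs : List X} → Unique xs → Injective _≡_ _≡_ (lookup xs)
lookup-injective (_ ∷ _) {zero} {zero} _ = refl
lookup-injective (x≢ ∷ _) {zero} {suc j} eq = contradiction eq (All.lookup x≢ (∈-lookup j))
lookup-injective (x≢ ∷ _) {suc i} {zero} eq = contradiction (sym eq) (All.lookup x≢ (∈-lookup i))
lookup-injective (_ ∷ u) {suc i} {suc j} eq = cong suc (lookup-injective u eq)

-- Pair sums and families with small pairwise intersections

sumFin-lookup-≤ : ∀ (f : X → ℕ) {c} {xs} → All (λ x → f x ≤ c) xs → sumFin (f ∘ lookup xs) ≤ length xs * c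
sumFin-lookup-≤ f [] = z≤n
sumFin-lookup-≤ f (p ∷ ps) = +-mono-≤ p (sumFin-lookup-≤ f ps)

pairSum-≤ : ∀ {c} {As : List (Subset n)} → AllPairs (λ A B → ∣ A ∩ B ∣ ≤ c) As →
  pairSum (lookup As) ≤ (length As C 2) * c
pairSum-≤ [] = z≤n
pairSum-≤ {c = c} {A ∷ As} (ps ∷ pps) = begin
  -- `pairSum` of a cons list computes to this: all terms with j = 0 are 0, and shifting both
  -- indices preserves their order.
  sumFin (λ j → ∣ A ∩ lookup As j ∣) + pairSum (lookup As)
    ≤⟨ +-mono-≤ (sumFin-lookup-≤ (λ B → ∣ A ∩ B ∣) ps) (pairSum-≤ pps) ⟩
  length As * c + (length As C 2) * c
    ≡⟨ sym (*-distribʳ-+ c (length As) _) ⟩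
  (length As + length As C 2) * c
    ≡⟨ cong (_* c) (sym ([1+m]C2≡m+mC2 (length As))) ⟩
  (suc (length As) C 2) * c ∎
  where open ≤-Reasoning

-- Passes from the injective functions of the hypothesis to the duplicate-free lists that the greedy
-- choices produce.
pairSum-lookup-≥ : ∀ {ℓ c} {𝓕 : List (Subset n)} →
  ((F : Fin ℓ → Subset n) → Injective _≡_ _≡_ F → (∀ i → F i ∈ 𝓕) → c ≤ pairSum F) →
  ∀ As → length As ≡ ℓ → Unique As → All (_∈ 𝓕) As → c ≤ pairSum (lookup As)
pairSum-lookup-≥ heavy As refl u As∈𝓕 =
  heavy (lookup As) (lookup-injective u) (λ i → All.lookup As∈𝓕 (∈-lookup i))

-- Two equal members would meet in k > c points. The inequality is requested only when a pair
-- exists, which matters for a single set with k = c = 1.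
unique-spread : ∀ {c k} {As : List (Subset n)} → All (λ A → ∣ A ∣ ≡ k) As →
  AllPairs (λ A B → ∣ A ∩ B ∣ ≤ c) As → (2 ≤ length As → c < k) → Unique As
unique-spread [] _ _ = []
unique-spread (_ ∷ []) _ _ = [] ∷ []
unique-spread {c = c} {k} {A ∷ _} (∣A∣ ∷ sizes@(_ ∷ _)) (ps ∷ pps) c<k =
  All.map distinct ps ∷ unique-spread sizes pps (λ _ → c<k (s≤s (s≤s z≤n)))
  where
  open ≤-Reasoning
  distinct : ∀ {B} → ∣ A ∩ B ∣ ≤ c → A ≢ B
  distinct ∣A∩A∣≤c refl = <-irrefl refl (begin-strict
    c         <⟨ c<k (s≤s (s≤s z≤n)) ⟩
    k         ≡⟨ sym ∣A∣ ⟩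
    ∣ A ∣     ≡⟨ cong ∣_∣ (sym (∩-idem A)) ⟩
    ∣ A ∩ A ∣ ≤⟨ ∣A∩A∣≤c ⟩
    c         ∎)

-- Greedy choice: either S hits every member, or some A misses S. In the latter case the points of A
-- outside Z, at most k of them, join S, so later choices meet A only inside Z. With Z empty this
-- yields disjoint sets, with Z = {x} a sunflower; keeping S off Z makes a resulting cover avoid the
-- kernel.
spread-or-cover : ∀ (Z : Subset n) {k} {𝓛} → All (λ A → ∣ A ∣ ≡ k) 𝓛 → ∀ m S → All (_∉ Z) S →
  (∃[ As ] length As ≡ m × All (_∈ 𝓛) As × All (¬_ ∘ Hits S) As × AllPairs (λ A B → ∣ A ∩ B ∣ ≤ ∣ Z ∣) As)
  ⊎ (∃[ S′ ] length S′ ≤ m * k + length S × All (_∉ Z) S′ × All (Hits S′) 𝓛)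
spread-or-cover Z sizes zero S S∉Z = inj₁ ([] , refl , [] , [] , [])
spread-or-cover Z {k} {𝓛} sizes (suc m) S S∉Z with any? (¬? ∘ hits? S) 𝓛
... | no ¬∃ = inj₂ (S , m≤n+m _ _ , S∉Z , All.map (decidable-stable (hits? S _)) (All.¬Any⇒All¬ 𝓛 ¬∃))
... | yes ∃A with find ∃A
...   | A , A∈𝓛 , A-free
  with spread-or-cover Z sizes m (elements (A ∩ ∁ Z) ++ S)
    (All.++⁺ (All.map (λ y∈ → x∈∁p⇒x∉p (proj₂ (x∈p∩q⁻ A (∁ Z) y∈))) (all-elements (A ∩ ∁ Z))) S∉Z)
...     | inj₁ (As , len , As∈𝓛 , free , spread) =
  inj₁ (A ∷ As , cong suc len , A∈𝓛 ∷ As∈𝓛 , A-free ∷ All.map (_∘ Any.++⁺ʳ _) free ,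
        All.map (λ ¬hit → p⊆q⇒∣p∣≤∣q∣ (meets-in-Z ¬hit)) free ∷ spread)
  where
  meets-in-Z : ∀ {B} → ¬ Hits (elements (A ∩ ∁ Z) ++ S) B → A ∩ B ⊆ Z
  meets-in-Z {B} ¬hit {y} y∈A∩B with y ∈? Z | x∈p∩q⁻ A B y∈A∩B
  ... | yes y∈Z | _ = y∈Z
  ... | no y∉Z | y∈A , y∈B =
    contradiction (Any.++⁺ˡ (hits-elements (x∈p∩q⁺ (y∈A , x∉p⇒x∈∁p y∉Z)) y∈B)) ¬hit
...     | inj₂ (S′ , len , S′∉Z , covers) = inj₂ (S′ , len′ , S′∉Z , covers)
  where
  open ≤-Reasoning
  len′ : length S′ ≤ suc m * k + length S
  len′ = begin
    length S′ ≤⟨ len ⟩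
    m * k + length (elements (A ∩ ∁ Z) ++ S) ≡⟨ cong (m * k +_) (length-++ (elements (A ∩ ∁ Z))) ⟩
    m * k + (length (elements (A ∩ ∁ Z)) + length S) ≡⟨ cong (λ e → m * k + (e + length S)) (length-elements (A ∩ ∁ Z)) ⟩
    m * k + (∣ A ∩ ∁ Z ∣ + length S)
      ≤⟨ +-monoʳ-≤ (m * k) (+-monoˡ-≤ (length S) (≤-trans (∣p∩q∣≤∣p∣ A (∁ Z)) (≤-reflexive (All.lookup sizes A∈𝓛)))) ⟩
    m * k + (k + length S) ≡⟨ sym (+-assoc (m * k) k _) ⟩
    m * k + k + length S ≡⟨ cong (_+ length S) (+-comm (m * k) k) ⟩
    suc m * k + length S ∎

-- The Erdős–Ko–Rado theorem for t-intersecting families on a large ground set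

∃-beyond : ∀ (A G T : Subset n) → ∣ T ∩ G ∣ < ∣ A ∩ G ∣ → ∃[ y ] y ∈ˢ A × y ∈ˢ G × y ∉ T
∃-beyond A G T lt with nonempty? ((A ∩ G) ∩ ∁ T)
... | yes (y , y∈) = let y∈A∩G , y∈∁T = x∈p∩q⁻ (A ∩ G) (∁ T) y∈
                         y∈A , y∈G = x∈p∩q⁻ A G y∈A∩G
                     in y , y∈A , y∈G , x∈∁p⇒x∉p y∈∁T
... | no empty = contradiction (p⊆q⇒∣p∣≤∣q∣ A∩G⊆T∩G) (<⇒≱ lt)
  where
  A∩G⊆T∩G : A ∩ G ⊆ T ∩ G
  A∩G⊆T∩G {y} y∈A∩G with y ∈? T
  ... | yes y∈T = x∈p∩q⁺ (y∈T , proj₂ (x∈p∩q⁻ A G y∈A∩G))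
  ... | no y∉T = contradiction (y , x∈p∩q⁺ (y∈A∩G , x∉p⇒x∈∁p y∉T)) empty

∣T∣≤∣T∩A∣⇒T⊆A : ∀ (T A : Subset n) → ∣ T ∣ ≤ ∣ T ∩ A ∣ → T ⊆ A
∣T∣≤∣T∩A∣⇒T⊆A T A le {y} y∈T with y ∈? A
... | yes y∈A = y∈A
... | no y∉A = contradiction le (<⇒≱ (p⊂q⇒∣p∣<∣q∣
  (p∩q⊆p T A , y , y∈T , λ y∈ → y∉A (proj₂ (x∈p∩q⁻ T A y∈)))))

module _ {t s : ℕ} (Y : Subset n) {𝓖 : List (Subset n)}
  (sizes : All (λ A → ∣ A ∣ ≡ t + s) 𝓖) (avoids : All (Avoids Y) 𝓖)
  (intersecting : ∀ {A B} → A ∈ 𝓖 → B ∈ 𝓖 → t ≤ ∣ A ∩ B ∣) where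

  -- If ∣ T ∣ ≤ t, some G ∈ 𝓖 meets T in fewer than t points, so every member of 𝓖 containing T
  -- contains one of the at most t + s points of G outside T.
  containing-count : (∀ T → ∣ T ∣ ≡ t → ¬ All (T ⊆_) 𝓖) → ∀ i T → ∣ T ∣ + i ≡ suc t →
    AtMost ((t + s) ^ i * ((n ∸ (t + ∣ Y ∣)) C⁻ s)) (λ A → A ∈ 𝓖 × T ⊆ A)
  containing-count no-kernel zero T ∣T∣ =
    AtMost-≤ (≤-reflexive (sym (*-identityˡ _)))
      (AtMost-⊆ (λ (A∈𝓖 , T⊆A) → All.lookup sizes A∈𝓖 , T⊆A , All.lookup avoids A∈𝓖)
        (between-count⁻ t s T Y (trans (sym (+-identityʳ _)) ∣T∣)))
  containing-count no-kernel (suc i) T ∣T∣ with any? (λ G → ∣ T ∩ G ∣ <? t) 𝓖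
  -- Now every member meets T in at least t points, so a member A forces ∣ T ∣ = t and T lies in all
  -- members: the excluded kernel.
  ... | no ¬∃ = AtMost-none λ {A} (A∈𝓖 , _) →
    let large : ∀ {B} → B ∈ 𝓖 → t ≤ ∣ T ∩ B ∣
        large B∈𝓖 = ≮⇒≥ λ lt → ¬∃ (lose B∈𝓖 lt)
        ∣T∣≤t = s≤s⁻¹ (≤-trans (s≤s (m≤m+n ∣ T ∣ i)) (≤-reflexive (trans (sym (+-suc ∣ T ∣ i)) ∣T∣)))
    in no-kernel T (≤-antisym ∣T∣≤t (≤-trans (large A∈𝓖) (∣p∩q∣≤∣p∣ T A)))
         (All.tabulate λ {B} B∈𝓖 → ∣T∣≤∣T∩A∣⇒T⊆A T B (≤-trans ∣T∣≤t (large B∈𝓖)))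
  ... | yes ∃G with find ∃G
  ...   | G , G∈𝓖 , small = AtMost-≤ bound (AtMost-cover S hit
    (All.map (λ {y} y∈ →
      let y∉T = x∈∁p⇒x∉p (proj₂ (x∈p∩q⁻ G (∁ T) y∈))
      in AtMost-⊆ (λ {A} ((A∈𝓖 , T⊆A) , y∈A) → A∈𝓖 , ∪⁅⁆-⊆ {A = A} T⊆A y∈A)
           (containing-count no-kernel i (T ∪ ⁅ y ⁆)
             (trans (cong (_+ i) (∣T∪⁅y⁆∣ T y∉T)) (trans (sym (+-suc ∣ T ∣ i)) ∣T∣))))
      (all-elements (G ∩ ∁ T))))
    where
    open ≤-Reasoning
    S = elements (G ∩ ∁ T)
    hit : ∀ {A} → A ∈ 𝓖 × T ⊆ A → Hits S A
    hit {A} (A∈𝓖 , _) =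
      let y , y∈A , y∈G , y∉T = ∃-beyond A G T (<-≤-trans small (intersecting A∈𝓖 G∈𝓖))
      in hits-elements (x∈p∩q⁺ (y∈G , x∉p⇒x∈∁p y∉T)) y∈A
    N = (n ∸ (t + ∣ Y ∣)) C⁻ s
    bound : length S * ((t + s) ^ i * N) ≤ (t + s) ^ suc i * N
    bound = begin
      length S * ((t + s) ^ i * N)
        ≤⟨ *-monoˡ-≤ ((t + s) ^ i * N) (≤-trans (≤-reflexive (length-elements (G ∩ ∁ T)))
             (≤-trans (∣p∩q∣≤∣p∣ G (∁ T)) (≤-reflexive (All.lookup sizes G∈𝓖)))) ⟩
      (t + s) * ((t + s) ^ i * N) ≡⟨ sym (*-assoc (t + s) ((t + s) ^ i) N) ⟩
      (t + s) ^ suc i * N ∎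

  -- With a common t-set, `between-count` gives the bound. Without one, t + 1 branchings from the
  -- empty set, each into at most k = t + s points, leave a constant times a binomial coefficient of
  -- lower order, which `C⁻-small` absorbs.
  erdős-ko-rado : Unique 𝓖 → (t + s) ^ suc t * s ≤ n ∸ (t + ∣ Y ∣) →
    length 𝓖 ≤ (n ∸ (t + ∣ Y ∣)) C s
  erdős-ko-rado unique n-large
    with anySubset? (λ T → (∣ T ∣ ≟ t) ×-dec All.all? (T ⊆?_) 𝓖)
  ... | yes (T , refl , T⊆) = between-count s T Y 𝓖 unique
    (All.tabulate λ A∈𝓖 → All.lookup sizes A∈𝓖 , All.lookup T⊆ A∈𝓖 , All.lookup avoids A∈𝓖)
  ... | no ¬∃ = ≤-trans
    (containing-count (λ T ∣T∣ T⊆ → ¬∃ (T , ∣T∣ , T⊆)) (suc t) ∅ (cong (_+ suc t) (∣⊥∣≡0 n))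
      𝓖 unique (All.tabulate λ {A} A∈𝓖 → A∈𝓖 , ⊆-min A))
    (C⁻-small ((t + s) ^ suc t) (n ∸ (t + ∣ Y ∣)) s n-large)

-- A point of large degree and the members avoiding it

module _ {t₀ s : ℕ} {𝓕 : List (Subset n)} (unique : Unique 𝓕) where
  private
    -- In terms of the theorem, t = ℓ - 2 and s = k - t. `N` is C(n - 2, k - 2), or 0 if k = 1: it
    -- bounds the number of k-sets through two given points.
    t = suc t₀
    k = t + s
    ℓ = 2 + t
    N = (n ∸ 1) C⁻ (t₀ + s)

  module _ (sizes : All (λ A → ∣ A ∣ ≡ k) 𝓕)
    (heavy : ∀ As → length As ≡ ℓ → Unique As → All (_∈ 𝓕) As → suc t C 2 ≤ pairSum (lookup As)) where

    -- If the greedy choice ran for ℓ rounds, it would give ℓ disjoint members with pair sum 0,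
    -- against the positive lower bound C(ℓ - 1, 2).
    cover : ∃[ S ] length S ≤ ℓ * k × All (Hits S) 𝓕
    cover with spread-or-cover ∅ sizes ℓ [] []
    ... | inj₂ (S , len , _ , covers) = S , ≤-trans len (≤-reflexive (+-identityʳ (ℓ * k))) , covers
    ... | inj₁ (As , len , As∈𝓕 , _ , spread) = contradiction
      (begin
        1 ≤⟨ s≤s z≤n ⟩
        t + t C 2 ≡⟨ sym ([1+m]C2≡m+mC2 t) ⟩
        suc t C 2 ≤⟨ heavy As len (unique-spread (All.map (All.lookup sizes) As∈𝓕) disjoint (λ _ → s≤s z≤n)) As∈𝓕 ⟩
        pairSum (lookup As) ≤⟨ pairSum-≤ disjoint ⟩
        (length As C 2) * 0 ≡⟨ *-zeroʳ (length As C 2) ⟩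
        0 ∎)
      λ ()
      where
      open ≤-Reasoning
      disjoint : AllPairs (λ A B → ∣ A ∩ B ∣ ≤ 0) As
      disjoint = subst (λ c → AllPairs (λ A B → ∣ A ∩ B ∣ ≤ c) As) (∣⊥∣≡0 n) spread

    module _ (x : Fin n) (deg-large : ℓ * k * N < length (filter (x ∈?_) 𝓕)) where
      private
        𝓕ˣ = filter (x ∈?_) 𝓕
        𝓖 = filter (¬? ∘ (x ∈?_)) 𝓕

      -- Each point other than x shares at most `N` members with x, so ℓk such points account for at
      -- most ℓkN members through x, fewer than its degree.
      small-covers-miss : ∀ S → All (_∉ ⁅ x ⁆) S → length S ≤ ℓ * k → ¬ All (Hits S) 𝓕ˣ
      small-covers-miss S S∉x len hits = <-irrefl refl (begin-strict
        ℓ * k * N    <⟨ deg-large ⟩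
        length 𝓕ˣ   ≤⟨ AtMost-cover S proj₁ (All.map codegree S∉x) 𝓕ˣ (Unique.filter⁺ (x ∈?_) unique)
                          (All.zip (hits , All.zip (All.filter⁺ (x ∈?_) sizes , All.all-filter (x ∈?_) 𝓕))) ⟩
        length S * N ≤⟨ *-monoˡ-≤ N len ⟩
        ℓ * k * N    ∎)
        where
        open ≤-Reasoning
        codegree : ∀ {y} → y ∉ ⁅ x ⁆ → AtMost N (λ A → (Hits S A × ∣ A ∣ ≡ k × x ∈ˢ A) × y ∈ˢ A)
        codegree {y} y∉x = AtMost-⊆
          (λ {A} ((_ , ∣A∣ , x∈A) , y∈A) → ∣A∣ ,
            ∪⁅⁆-⊆ {A = A} (⁅⁆-⊆ {A = A} x∈A) y∈A , avoids-∅ A)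
          (subst (λ c → AtMost ((n ∸ suc c) C⁻ (t₀ + s)) (Between k (⁅ x ⁆ ∪ ⁅ y ⁆) ∅)) (∣⊥∣≡0 n)
            (between-count⁻ 1 (t₀ + s) (⁅ x ⁆ ∪ ⁅ y ⁆) ∅
              (trans (∣T∪⁅y⁆∣ ⁅ x ⁆ y∉x) (cong suc (∣⁅x⁆∣≡1 x)))))

      -- Complete A and B to ℓ sets by a sunflower in 𝓕ˣ with kernel {x} that is disjoint from A ∪ B.
      avoiding-intersect : ∀ {A B} → A ∈ 𝓖 → B ∈ 𝓖 → t ≤ ∣ A ∩ B ∣
      avoiding-intersect {A} {B} A∈𝓖 B∈𝓖 with ≡-dec Bool._≟_ A B
      -- The pair-sum hypothesis speaks of distinct sets only; for A = B the size k = t + s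
      -- suffices.
      ... | yes refl = ≤-trans (m≤m+n t s) (≤-reflexive (sym (trans (cong ∣_∣ (∩-idem A))
        (All.lookup sizes (proj₁ (∈-filter⁻ (¬? ∘ (x ∈?_)) A∈𝓖))))))
      ... | no A≢B with ∈-filter⁻ (¬? ∘ (x ∈?_)) A∈𝓖 | ∈-filter⁻ (¬? ∘ (x ∈?_)) B∈𝓖
      ...   | A∈𝓕 , x∉A | B∈𝓕 , x∉B
        -- Seeding with the points of A and B makes the chosen sets disjoint from both. As x lies in
        -- neither, the seed stays off the kernel.
        with spread-or-cover ⁅ x ⁆ (All.filter⁺ (x ∈?_) sizes) t (elements A ++ elements B)
          (All.++⁺ (All.map (∉⁅x⁆ x∉A) (all-elements A)) (All.map (∉⁅x⁆ x∉B) (all-elements B)))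
        where
        ∉⁅x⁆ : ∀ {y D} → x ∉ D → y ∈ˢ D → y ∉ ⁅ x ⁆
        ∉⁅x⁆ x∉D y∈D = x≢y⇒x∉⁅y⁆ λ { refl → x∉D y∈D }
      -- The 2k seed points and k for each of t rounds make ℓk, just within reach of
      -- `small-covers-miss`.
      ...     | inj₂ (S , len , S∉x , covers) = contradiction covers (small-covers-miss S S∉x (begin
        length S ≤⟨ len ⟩
        t * k + length (elements A ++ elements B) ≡⟨ cong (t * k +_) (length-++ (elements A)) ⟩
        t * k + (length (elements A) + length (elements B))
          ≡⟨ cong₂ (λ a b → t * k + (a + b)) (trans (length-elements A) (All.lookup sizes A∈𝓕))
                                            (trans (length-elements B) (All.lookup sizes B∈𝓕)) ⟩
        t * k + (k + k) ≡⟨ +-comm (t * k) (k + k) ⟩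
        k + k + t * k ≡⟨ +-assoc k k (t * k) ⟩
        ℓ * k ∎))
        where open ≤-Reasoning
      -- Only ∣ A ∩ B ∣ and the C(t, 2) pairs within `As`, at most 1 each, contribute. Cancelling
      -- C(t, 2) from C(t + 1, 2) leaves t.
      ...     | inj₁ (As , len , As∈𝓕ˣ , free , spread) = +-cancelʳ-≤ (t C 2) t ∣ A ∩ B ∣ (begin
        t + t C 2 ≡⟨ sym ([1+m]C2≡m+mC2 t) ⟩
        suc t C 2 ≤⟨ heavy (A ∷ B ∷ As) (cong (2 +_) len)
                       ((A≢B ∷ All.map (≢-∌ x∉A) As∋x) ∷ All.map (≢-∌ x∉B) As∋x ∷
                         unique-spread (All.map (All.lookup sizes) As∈𝓕) sunflower
                           (λ 2≤ → ≤-trans 2≤ (≤-trans (≤-reflexive len) (m≤m+n t s))))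
                       (A∈𝓕 ∷ B∈𝓕 ∷ As∈𝓕) ⟩
        (∣ A ∩ B ∣ + sumFin (λ i → ∣ A ∩ lookup As i ∣)) + (sumFin (λ i → ∣ B ∩ lookup As i ∣) + pairSum (lookup As))
          ≤⟨ +-mono-≤ (+-monoʳ-≤ ∣ A ∩ B ∣ (no-overlap A (_∘ Any.++⁺ˡ)))
                      (+-mono-≤ (no-overlap B (_∘ Any.++⁺ʳ (elements A))) (pairSum-≤ sunflower)) ⟩
        (∣ A ∩ B ∣ + 0) + (length As C 2) * 1 ≡⟨ cong₂ _+_ (+-identityʳ ∣ A ∩ B ∣) (*-identityʳ (length As C 2)) ⟩
        ∣ A ∩ B ∣ + length As C 2 ≡⟨ cong (λ m → ∣ A ∩ B ∣ + m C 2) len ⟩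
        ∣ A ∩ B ∣ + t C 2 ∎)
        where
        open ≤-Reasoning
        As∈𝓕 = All.map (proj₁ ∘ ∈-filter⁻ (x ∈?_)) As∈𝓕ˣ
        As∋x : All (x ∈ˢ_) As
        As∋x = All.map (λ D∈ → proj₂ (∈-filter⁻ (x ∈?_) {xs = 𝓕} D∈)) As∈𝓕ˣ
        ≢-∌ : ∀ {D E} → x ∉ D → x ∈ˢ E → D ≢ E
        ≢-∌ x∉D x∈E refl = x∉D x∈E
        sunflower : AllPairs (λ D E → ∣ D ∩ E ∣ ≤ 1) As
        sunflower = subst (λ c → AllPairs (λ D E → ∣ D ∩ E ∣ ≤ c) As) (∣⁅x⁆∣≡1 x) spread
        no-overlap : ∀ D → (∀ {E} → ¬ Hits (elements A ++ elements B) E → ¬ Hits (elements D) E) →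
          sumFin (λ i → ∣ D ∩ lookup As i ∣) ≤ 0
        no-overlap D restrict = ≤-trans
          (sumFin-lookup-≤ (λ E → ∣ D ∩ E ∣) (All.map (λ {E} ¬hit → ≤-trans
            (p⊆q⇒∣p∣≤∣q∣ {q = ∅} λ y∈ → let y∈D , y∈E = x∈p∩q⁻ D E y∈ in
              contradiction (hits-elements y∈D y∈E) (restrict ¬hit))
            (≤-reflexive (∣⊥∣≡0 n))) free))
          (≤-reflexive (*-zeroʳ (length As)))

      star-bound : k ^ suc t * s ≤ n ∸ suc t → length 𝓕 ≤ (n ∸ 1) C (t₀ + s) + (n ∸ suc t) C s
      star-bound n-large = begin
        length 𝓕 ≡⟨ length-filter-∁ (x ∈?_) 𝓕 ⟩
        length 𝓕ˣ + length 𝓖 ≤⟨ +-mono-≤ 𝓕ˣ-bound 𝓖-bound ⟩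
        (n ∸ 1) C (t₀ + s) + (n ∸ suc t) C s ∎
        where
        open ≤-Reasoning
        in-star : ∀ {A} → ∣ A ∣ ≡ k × x ∈ˢ A → Between k ⁅ x ⁆ ∅ A
        in-star {A} (∣A∣ , x∈A) = ∣A∣ , ⁅⁆-⊆ x∈A , avoids-∅ A
        𝓕ˣ-bound : length 𝓕ˣ ≤ (n ∸ 1) C (t₀ + s)
        𝓕ˣ-bound = subst₂ (λ a b → AtMost ((n ∸ (a + b)) C (t₀ + s)) (Between (a + (t₀ + s)) ⁅ x ⁆ ∅))
          (∣⁅x⁆∣≡1 x) (∣⊥∣≡0 n) (between-count (t₀ + s) ⁅ x ⁆ ∅) 𝓕ˣ (Unique.filter⁺ (x ∈?_) unique)
          (All.map in-star
            (All.zip (All.filter⁺ (x ∈?_) sizes , All.all-filter (x ∈?_) 𝓕)))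
        avoids-x : ∀ {A} → x ∉ A → Avoids ⁅ x ⁆ A
        avoids-x {A} x∉A z∈ z∈A = x∉A (subst (_∈ˢ A) (x∈⁅y⁆⇒x≡y x z∈) z∈A)
        free≡ : n ∸ (t + ∣ ⁅ x ⁆ ∣) ≡ n ∸ suc t
        free≡ = cong (n ∸_) (trans (cong (t +_) (∣⁅x⁆∣≡1 x)) (+-comm t 1))
        𝓖-bound : length 𝓖 ≤ (n ∸ suc t) C s
        𝓖-bound = subst (λ m → length 𝓖 ≤ m C s) free≡
          -- Forbidding x is how the ground set loses one point.
          (erdős-ko-rado ⁅ x ⁆ (All.filter⁺ (¬? ∘ (x ∈?_)) sizes)
            (All.map avoids-x (All.all-filter (¬? ∘ (x ∈?_)) 𝓕))
            avoiding-intersect (Unique.filter⁺ (¬? ∘ (x ∈?_)) unique)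
            (≤-trans n-large (≤-reflexive (sym free≡))))

    -- If no point of the cover has degree above ℓkN, then the family has at most (ℓk)²N members,
    -- and for large n this is below the first binomial coefficient alone. Otherwise `star-bound`
    -- applies.
    family-bound : ℓ * k * (ℓ * k) * (t₀ + s) ≤ n ∸ 1 → k ^ suc t * s ≤ n ∸ suc t →
      length 𝓕 ≤ (n ∸ 1) C (t₀ + s) + (n ∸ suc t) C s
    family-bound n-large₁ n-large₂ with cover
    ... | S , len , covers with any? (λ x → ℓ * k * N <? length (filter (x ∈?_) 𝓕)) S
    ...   | yes ∃x = let x , _ , deg-large = find ∃x in star-bound x deg-large n-large₂
    ...   | no ¬∃ = ≤-trans (begin
      length 𝓕 ≤⟨ length-cover S (ℓ * k * N) 𝓕 covers (All.map ≮⇒≥ (All.¬Any⇒All¬ S ¬∃)) ⟩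
      length S * (ℓ * k * N) ≤⟨ *-monoˡ-≤ (ℓ * k * N) len ⟩
      ℓ * k * (ℓ * k * N) ≡⟨ sym (*-assoc (ℓ * k) (ℓ * k) N) ⟩
      ℓ * k * (ℓ * k) * N ≤⟨ C⁻-small (ℓ * k * (ℓ * k)) (n ∸ 1) (t₀ + s) n-large₁ ⟩
      (n ∸ 1) C (t₀ + s) ∎) (m≤m+n _ _)
      where open ≤-Reasoning

-- Choice of the threshold n₀

theorem5 : (k ℓ : ℕ) → 3 ≤ ℓ → ℓ ≤ k + 2 →
    ∃[ n₀ ] ((n : ℕ) → n₀ ≤ n →
    (𝓕 : List (Subset n)) → Unique 𝓕 → All (λ A → ∣ A ∣ ≡ k) 𝓕 →
    ((F : Fin ℓ → Subset n) → Injective _≡_ _≡_ F → (∀ i → F i ∈ 𝓕) →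
    (ℓ ∸ 1) C 2 ≤ pairSum F) →
    length 𝓕 ≤ (n ∸ 1) C (k ∸ 1) + (n + 1 ∸ ℓ) C (k + 2 ∸ ℓ))
theorem5 k (suc (suc (suc t₀))) (s≤s (s≤s (s≤s z≤n))) ℓ≤k+2 rewrite +-comm k 2
  -- After the rewrite, `k + 2 ∸ ℓ` computes to `k ∸ suc t₀`; naming it s turns k into t + s.
  with k ∸ suc t₀ | m+[n∸m]≡n (s≤s⁻¹ (s≤s⁻¹ ℓ≤k+2))
-- The two summands of n₀ give a ≤ n - 1, for covers without a point of large degree, and b ≤ n - (ℓ
-- - 1), for `erdős-ko-rado`.
... | s | refl = (a + 1) + (b + (2 + t₀)) , λ n n₀≤n 𝓕 unique sizes heavy →
  subst (λ m → length 𝓕 ≤ (n ∸ 1) C (t₀ + s) + (m ∸ (3 + t₀)) C s) (+-comm 1 n)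
    (family-bound unique sizes
      (pairSum-lookup-≥ heavy)
      (m+n≤o⇒m≤o∸n a (m+n≤o⇒m≤o (a + 1) n₀≤n))
      (m+n≤o⇒m≤o∸n b (m+n≤o⇒n≤o (a + 1) n₀≤n)))
  where
  a = (3 + t₀) * (suc t₀ + s) * ((3 + t₀) * (suc t₀ + s)) * (t₀ + s)
  b = (suc t₀ + s) ^ (2 + t₀) * s
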